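{- Let $q\ge 2$ be a prime power and let $r=q+1$. Then the graph $R_q$ is a $(\{r,2r-3\};5)$-cage attaining Downs' lower bound, i.e. $n(\{r,2r-3\};5)=r(2r-3)+1$.
   Context: All graphs are finite, undirected and simple. The girth of a graph is the length of a shortest cycle. For a finite nonempty set $D$ of integers $\ge 2$, a $(D;g)$-graph is a graph of girth exactly $g$ whose set of vertex degrees is exactly $D$; $n(D;g)$ is the minimum order (number of vertices) of a $(D;g)$-graph, and a $(D;g)$-cage is a $(D;g)$-graph of order $n(D;g)$. (If $q=2$ then $r=2r-3=3$ and $\{r,2r-3\}=\{3\}$.) Downs' lower bound for girth $5$ and $D=\{r,m\}$, $r\le m$, is $n(\{r,m\};5)\ge 1+m+m(r-1)=rm+1$. Let $GF(q)$ be the field with $q$ elements and $GF^*(q)=GF(q)\setminus\{0\}$. The graph $B_q$ is the bipartite graph with vertex classes $V_0=\{(x,y)_0: x,y\in GF(q)\}$ and $V_1=\{(m,b)_1: m,b\in GF(q)\}$, in which $(x,y)_0$ is adjacent to $(m,b)_1$ if and only if $y=mx+b$. The graph $A_q$ is obtained from $B_q$ by adding $q$ new vertices $(q,x)_1$, $x\in GF(q)$ (here the first coordinate $q$ is a formal symbol not in $GF(q)$), and joining $(q,x)_1$ to $(x,y)_0$ for all $x,y\in GF(q)$. The graph $R_q$ has vertex set $V(R_q)=V(A_q)$ and edge set $E(R_q)=E(A_q)\cup\{(m,0)_1(m,b)_1 : b\in GF^*(q),\ m\in GF(q)\cup\{q\}\}$. -}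

module Defs where

open import Algebra.Apartness.Structures using (IsHeytingField)
open import Data.Fin.Base using (Fin)
open import Data.Fin.Properties using (+↔⊎; *↔×; 1↔⊤; inj⇒≟)
open import Data.List.Base using (List; []; _∷_; [_]; _++_; length; filter; tabulate)
open import Data.List.Membership.Propositional using (_∈_)
open import Data.List.Relation.Unary.Linked using (Linked)
open import Data.List.Relation.Unary.Unique.Propositional using (Unique)
open import Data.Maybe.Base using (Maybe; just; nothing)
open import Data.Maybe.Properties using (≡-dec)
open import Data.Nat.Base using (ℕ; suc; _+_; _*_; _∸_; _^_; _≤_)
open import Data.Nat.Primality using (Prime)
open import Data.Product.Base using (_×_; _,_; ∃-syntax)
open import Data.Product.Function.NonDependent.Propositional using (_×-↔_)
open import Data.Sum.Base using (_⊎_; inj₁; inj₂)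
open import Data.Sum.Function.Propositional using (_⊎-↔_)
open import Data.Unit.Base using (⊤; tt)
open import Function.Base using (_∘_)
open import Function.Bundles using (_↔_; _⇔_; Inverse; mk↔ₛ′)
open import Function.Construct.Composition using (_↔-∘_)
open import Function.Construct.Symmetry using (↔-sym)
open import Function.Properties.Inverse using (↔⇒↣)
open import Relation.Binary.Construct.Closure.Symmetric using (SymClosure; fwd; bwd; symmetric)
open import Relation.Binary.Definitions using (Decidable; DecidableEquality; Irreflexive; Symmetric)
open import Relation.Binary.PropositionalEquality using (_≡_; _≢_; refl)
open import Relation.Nullary.Decidable using (Dec; yes; no; map′; _×-dec_; _⊎-dec_; ¬?)

IsPrimePower : ℕ → Set
IsPrimePower q = ∃[ p ] ∃[ k ] (Prime p × 1 ≤ k × q ≡ p ^ k)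

------------------------------------------------------------------------
-- Graphs

record Graph : Set₁ where
  infix 4 _∼_ _∼?_
  field
    Vertex   : Set
    order    : ℕ
    enum     : Fin order ↔ Vertex
    _∼_      : Vertex → Vertex → Set
    ∼-sym    : Symmetric _∼_
    ∼-irrefl : Irreflexive _≡_ _∼_
    _∼?_     : Decidable _∼_

  vertices : List Vertex
  vertices = tabulate (Inverse.to enum)

  degree : Vertex → ℕ
  degree v = length (filter (v ∼?_) vertices)

  -- A cycle  start, rest₁, …, restₖ₋₁, start  with k edges.
  record Cycle (k : ℕ) : Set where
    field
      start    : Vertex
      rest     : List Vertex
      length≡k : length (start ∷ rest) ≡ k
      3≤k      : 3 ≤ k
      distinct : Unique (start ∷ rest)
      closed   : Linked _∼_ (start ∷ rest ++ [ start ])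

  HasGirth : ℕ → Set
  HasGirth g = Cycle g × (∀ k → Cycle k → g ≤ k)

  -- D is read as a set: order and repetitions of its entries are irrelevant.
  HasDegreeSet : List ℕ → Set
  HasDegreeSet D = ∀ d → d ∈ D ⇔ (∃[ v ] degree v ≡ d)

open Graph using (order; HasGirth; HasDegreeSet)

-- The (D;g)-graphs.
Is[_⨾_]Graph : List ℕ → ℕ → Graph → Set
Is[ D ⨾ g ]Graph G = HasGirth G g × HasDegreeSet G D

-- n(D;g) = n, as a relation, since n(D;g) is defined only when some
-- (D;g)-graph exists.
n[_⨾_]≡_ : List ℕ → ℕ → ℕ → Set₁
n[ D ⨾ g ]≡ n =
  (∃[ G ] (Is[ D ⨾ g ]Graph G × order G ≡ n)) ×
  (∀ G → Is[ D ⨾ g ]Graph G → n ≤ order G)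

Is[_⨾_]Cage : List ℕ → ℕ → Graph → Set₁
Is[ D ⨾ g ]Cage G = Is[ D ⨾ g ]Graph G × (n[ D ⨾ g ]≡ order G)

-- Downs' lower bound for girth 5 and degree set {r , m} with r ≤ m.
downsBound₅ : ℕ → ℕ → ℕ
downsBound₅ r m = 1 + m + m * (r ∸ 1)

------------------------------------------------------------------------
-- Finite fields

-- Equality on a finite type is decidable, so a Heyting field whose
-- apartness relation is _≢_ is a field in the usual sense.
record FieldOfOrder (q : ℕ) : Set₁ where
  infixl 6 _+ᶠ_
  infixl 7 _*ᶠ_
  field
    Carrier        : Set
    _+ᶠ_ _*ᶠ_      : Carrier → Carrier → Carrier
    -ᶠ_            : Carrier → Carrier
    0ᶠ 1ᶠ          : Carrier
    isHeytingField : IsHeytingField _≡_ _≢_ _+ᶠ_ _*ᶠ_ -ᶠ_ 0ᶠ 1ᶠ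
    enum           : Fin q ↔ Carrier

  infix 4 _≟_
  _≟_ : DecidableEquality Carrier
  _≟_ = inj⇒≟ (↔⇒↣ (↔-sym enum))

------------------------------------------------------------------------
-- The graph R_q

module _ {q : ℕ} (F : FieldOfOrder q) where
  open FieldOfOrder F

  -- The common vertex set of A_q and R_q: (x , y)₀ is  point x y  and
  -- (m , b)₁ is  line m b.  In the first coordinate of a line, nothing is the
  -- formal symbol q ∉ GF(q); the vertices of B_q are all the others.
  data V : Set where
    point : Carrier → Carrier → V
    line  : Maybe Carrier → Carrier → V

  -- Each edge of B_q, A_q, R_q is listed below in one orientation only.
  data EB : V → V → Set where
    incident : ∀ {x y m b} → y ≡ m *ᶠ x +ᶠ b → EB (point x y) (line (just m) b)

  data EA : V → V → Set where
    fromB : ∀ {u v} → EB u v → EA u v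
    joinA : ∀ {x y} → EA (point x y) (line nothing x)

  data ER : V → V → Set where
    fromA : ∀ {u v} → EA u v → ER u v
    star  : ∀ {m b} → b ≢ 0ᶠ → ER (line m 0ᶠ) (line m b)

  private
    Maybe↔ : (⊤ ⊎ Carrier) ↔ Maybe Carrier
    Maybe↔ = mk↔ₛ′ (λ { (inj₁ _) → nothing ; (inj₂ x) → just x })
                   (λ { nothing → inj₁ tt ; (just x) → inj₂ x })
                   (λ { nothing → refl ; (just _) → refl })
                   (λ { (inj₁ _) → refl ; (inj₂ _) → refl })

    V↔ : ((Carrier × Carrier) ⊎ (Maybe Carrier × Carrier)) ↔ V
    V↔ = mk↔ₛ′ (λ { (inj₁ (x , y)) → point x y ; (inj₂ (m , b)) → line m b })
               (λ { (point x y) → inj₁ (x , y) ; (line m b) → inj₂ (m , b) })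
               (λ { (point _ _) → refl ; (line _ _) → refl })
               (λ { (inj₁ _) → refl ; (inj₂ _) → refl })

  enumV : Fin (q * q + (1 + q) * q) ↔ V
  enumV = V↔ ↔-∘ ((pairs ⊎-↔ linePairs) ↔-∘ +↔⊎)
    where
    pairs : Fin (q * q) ↔ (Carrier × Carrier)
    pairs = (enum ×-↔ enum) ↔-∘ *↔×
    slopes : Fin (1 + q) ↔ Maybe Carrier
    slopes = Maybe↔ ↔-∘ ((1↔⊤ ⊎-↔ enum) ↔-∘ +↔⊎)
    linePairs : Fin ((1 + q) * q) ↔ (Maybe Carrier × Carrier)
    linePairs = (slopes ×-↔ enum) ↔-∘ *↔×

  ER? : Decidable ER
  ER? (point x y) (point x′ y′) = no λ { (fromA (fromB ())) }
  ER? (point x y) (line (just m) b) =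
    map′ (fromA ∘ fromB ∘ incident) (λ { (fromA (fromB (incident e))) → e })
         (y ≟ m *ᶠ x +ᶠ b)
  ER? (point x y) (line nothing b) =
    map′ (λ { refl → fromA joinA }) (λ { (fromA joinA) → refl ; (fromA (fromB ())) })
         (x ≟ b)
  ER? (line m b) (point x y) = no λ { (fromA (fromB ())) }
  ER? (line m b) (line m′ b′) =
    map′ (λ { (refl , refl , b′≢0) → star b′≢0 })
         (λ { (star b′≢0) → refl , refl , b′≢0 ; (fromA (fromB ())) })
         (≡-dec _≟_ m m′ ×-dec b ≟ 0ᶠ ×-dec ¬? (b′ ≟ 0ᶠ))

  ER-irrefl : Irreflexive _≡_ ER
  ER-irrefl ()   (fromA (fromB (incident _)))
  ER-irrefl ()   (fromA joinA)
  ER-irrefl refl (star b≢0) = b≢0 refl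

  R : Graph
  R = record
    { Vertex   = V
    ; order    = q * q + (1 + q) * q
    ; enum     = enumV
    ; _∼_      = SymClosure ER
    ; ∼-sym    = symmetric ER
    ; ∼-irrefl = λ { refl (fwd e) → ER-irrefl refl e ; refl (bwd e) → ER-irrefl refl e }
    ; _∼?_     = λ u v → map′ (λ { (inj₁ e) → fwd e ; (inj₂ e) → bwd e })
                              (λ { (fwd e) → inj₁ e ; (bwd e) → inj₂ e })
                              (ER? u v ⊎-dec ER? v u)
    }

{-# OPTIONS --safe #-}
-- Adjacent or parallel lines have no point in common, and two distinct points
-- lie on at most one line, so R_q has no 3-cycle and no 4-cycle.  Conversely, a
-- vertex v of degree m in a graph without 3- and 4-cycles has m disjoint
-- branches, each consisting of a neighbour u of v and the neighbours of u other
-- than v.  A branch has deg u ≥ r vertices, so the order is at least 1 + m r.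
module Submission where

open import Defs
open import Algebra.Apartness.Structures using (IsHeytingField)
open import Algebra.Bundles using (CommutativeRing)
import Algebra.Properties.Ring as RingProperties
open import Data.Empty using (⊥; ⊥-elim)
open import Data.Fin.Base using (Fin)
open import Data.Fin.Properties using (inj⇒≟; injective⇒≤)
open import Data.List.Base using (List; []; _∷_; [_]; _++_; concatMap; filter; length; lookup; map; tabulate)
open import Data.List.Properties using (length-++; length-map; length-tabulate)
open import Data.List.Membership.Propositional using (_∈_; find)
open import Data.List.Membership.Propositional.Properties
  using (∈-lookup; ∈-tabulate⁺; ∈-filter⁺; ∈-filter⁻; ∈-map⁺; ∈-map⁻; ∈-++⁺ˡ; ∈-++⁺ʳ; ∈-++⁻; ∈-concatMap⁻)
open import Data.List.Membership.Setoid.Properties using (index-injective)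
open import Data.List.Relation.Binary.Subset.Propositional using (_⊆_)
open import Data.List.Relation.Unary.All as All using (All; []; _∷_)
open import Data.List.Relation.Unary.All.Properties using (¬Any⇒All¬)
open import Data.List.Relation.Unary.AllPairs using ([]; _∷_)
open import Data.List.Relation.Unary.Any as Any using (here; there)
open import Data.List.Relation.Unary.Linked using (Linked; [-]; _∷_)
open import Data.List.Relation.Unary.Unique.Propositional using (Unique)
import Data.List.Relation.Unary.Unique.Propositional.Properties as Unique
open import Data.Maybe.Base using (Maybe; just; nothing)
open import Data.Maybe.Properties using (just-injective; ≡-dec)
open import Data.Nat.Base using (ℕ; suc; _+_; _*_; _∸_; _≤_; z≤n; s≤s)
import Data.Nat.Properties as ℕ
open import Data.Nat.Tactic.RingSolver using (solve-∀)
open import Data.Product.Base using (_×_; _,_; proj₁; proj₂)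
open import Data.Sum.Base as Sum using (_⊎_; inj₁; inj₂)
open import Function.Base using (_∘_; case_of_)
open import Function.Bundles using (_↔_; Equivalence; Injection; Inverse; mk⇔)
open import Function.Construct.Symmetry using (↔-sym)
open import Function.Properties.Inverse using (↔⇒↣)
open import Relation.Binary.Construct.Closure.Symmetric using (fwd; bwd)
open import Relation.Binary.Definitions using (DecidableEquality)
open import Relation.Binary.PropositionalEquality
  using (_≡_; _≢_; refl; sym; trans; cong; cong₂; subst; setoid; ≢-sym; module ≡-Reasoning)
open import Relation.Nullary.Decidable using (yes; no; ¬?)
open import Relation.Nullary.Negation using (¬_; contradiction)

-- Counting with lists free of repetitions.

module _ {A : Set} where

  lookup-injective : ∀ {xs : List A} → Unique xs →
                     ∀ {i j} → lookup xs i ≡ lookup xs j → i ≡ j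
  lookup-injective {x ∷ xs} _ {Fin.zero} {Fin.zero} _ = refl
  lookup-injective {x ∷ xs} (x∉ ∷ _) {Fin.zero} {Fin.suc j} eq =
    contradiction eq (All.lookup x∉ (∈-lookup j))
  lookup-injective {x ∷ xs} (x∉ ∷ _) {Fin.suc i} {Fin.zero} eq =
    contradiction (sym eq) (All.lookup x∉ (∈-lookup i))
  lookup-injective {x ∷ xs} (_ ∷ !xs) {Fin.suc i} {Fin.suc j} eq =
    cong Fin.suc (lookup-injective !xs eq)

  -- Sending each position of `xs` to a position in `ys` of the same entry is an injection between
  -- initial segments of the naturals, because `xs` does not repeat entries.
  unique-⊆⇒length≤ : ∀ {xs ys : List A} → Unique xs → xs ⊆ ys → length xs ≤ length ys
  unique-⊆⇒length≤ {xs} !xs xs⊆ys = injective⇒≤ {f = λ i → Any.index (xs⊆ys (∈-lookup {xs = xs} i))}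
    (lookup-injective !xs ∘ index-injective (setoid A) (xs⊆ys (∈-lookup _)) (xs⊆ys (∈-lookup _)))

  unique-⊆-⊇⇒length≡ : ∀ {xs ys : List A} → Unique xs → Unique ys →
                       xs ⊆ ys → ys ⊆ xs → length xs ≡ length ys
  unique-⊆-⊇⇒length≡ !xs !ys xs⊆ys ys⊆xs =
    ℕ.≤-antisym (unique-⊆⇒length≤ !xs xs⊆ys) (unique-⊆⇒length≤ !ys ys⊆xs)

  module _ {n} (enumeration : Fin n ↔ A) where
    open Inverse enumeration using (to; from; inverseˡ)

    tabulate-unique : Unique (tabulate to)
    tabulate-unique = Unique.tabulate⁺ (Injection.injective (↔⇒↣ enumeration))

    tabulate-complete : ∀ x → x ∈ tabulate to
    tabulate-complete x = subst (_∈ tabulate to) (inverseˡ refl) (∈-tabulate⁺ (from x))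

  ∉⇒unique-∷ : ∀ {x} {xs : List A} → ¬ x ∈ xs → Unique xs → Unique (x ∷ xs)
  ∉⇒unique-∷ x∉xs !xs = ¬Any⇒All¬ _ x∉xs ∷ !xs

  module _ (_≟_ : DecidableEquality A) where

    remove : A → List A → List A
    remove x = filter (λ y → ¬? (y ≟ x))

    remove-∉ : ∀ x xs → ¬ x ∈ remove x xs
    remove-∉ x xs x∈ = proj₂ (∈-filter⁻ (λ y → ¬? (y ≟ x)) {xs = xs} x∈) refl

    ⊆-∷-remove : ∀ x xs → xs ⊆ x ∷ remove x xs
    ⊆-∷-remove x xs {y} y∈xs with y ≟ x
    ... | yes refl = here refl
    ... | no  y≢x  = there (∈-filter⁺ (λ y → ¬? (y ≟ x)) y∈xs y≢x)

    length-remove : ∀ {x xs} → Unique xs → x ∈ xs → suc (length (remove x xs)) ≡ length xs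
    length-remove {x} {xs} !xs x∈xs = unique-⊆-⊇⇒length≡
      (∉⇒unique-∷ (remove-∉ x xs) (Unique.filter⁺ (λ y → ¬? (y ≟ x)) !xs)) !xs
      (λ { (here refl) → x∈xs ; (there y∈) → proj₁ (∈-filter⁻ (λ y → ¬? (y ≟ x)) y∈) })
      (⊆-∷-remove x xs)

module _ {A B : Set} (f : A → List B) where

  -- The last hypothesis is pairwise disjointness in positive form: a shared entry forces the two
  -- arguments to coincide, which the distinctness of the entries of `xs` then refutes.
  concatMap-unique : ∀ {xs} → Unique xs → All (Unique ∘ f) xs →
    (∀ {x y z} → x ∈ xs → y ∈ xs → z ∈ f x → z ∈ f y → x ≡ y) → Unique (concatMap f xs)
  concatMap-unique [] [] _ = []
  concatMap-unique {x ∷ xs} (x∉xs ∷ !xs) (!fx ∷ !fxs) disjoint = Unique.++⁺ !fx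
    (concatMap-unique !xs !fxs (λ x∈ y∈ → disjoint (there x∈) (there y∈)))
    λ (z∈fx , z∈) → let y , y∈xs , z∈fy = find (∈-concatMap⁻ f {xs = xs} z∈) in
      All.lookup x∉xs y∈xs (disjoint (here refl) (there y∈xs) z∈fx z∈fy)

  length-concatMap-≥ : ∀ {n} → (∀ x → n ≤ length (f x)) → ∀ xs →
                       length xs * n ≤ length (concatMap f xs)
  length-concatMap-≥ n≤ [] = z≤n
  length-concatMap-≥ {n} n≤ (x ∷ xs) =
    subst (n + length xs * n ≤_) (sym (length-++ (f x)))
      (ℕ.+-mono-≤ (n≤ x) (length-concatMap-≥ n≤ xs))

-- Graphs without 3-cycles and 4-cycles

module _ (G : Graph) where
  open Graph G

  private
    _≟ᵥ_ : DecidableEquality Vertex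
    _≟ᵥ_ = inj⇒≟ (↔⇒↣ (↔-sym enum))

    neighbours : Vertex → List Vertex
    neighbours v = filter (v ∼?_) vertices

    neighbours-unique : ∀ v → Unique (neighbours v)
    neighbours-unique v = Unique.filter⁺ (v ∼?_) (tabulate-unique enum)

    ∈-neighbours⁺ : ∀ {v w} → v ∼ w → w ∈ neighbours v
    ∈-neighbours⁺ {v} {w} = ∈-filter⁺ (v ∼?_) (tabulate-complete enum w)

    ∈-neighbours⁻ : ∀ {v w} → w ∈ neighbours v → v ∼ w
    ∈-neighbours⁻ {v} = proj₂ ∘ ∈-filter⁻ (v ∼?_) {xs = vertices}

  length≤order : ∀ {xs} → Unique xs → length xs ≤ order
  length≤order !xs = subst (_ ≤_) (length-tabulate (Inverse.to enum))
    (unique-⊆⇒length≤ !xs (λ {v} _ → tabulate-complete enum v))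

  -- Reduces every degree computation in R_q to exhibiting an explicit list of neighbours.
  degree-≡ : ∀ {v xs} → Unique xs → (∀ {w} → w ∈ xs → v ∼ w) → (∀ {w} → v ∼ w → w ∈ xs) →
             degree v ≡ length xs
  degree-≡ {v} !xs sound complete = unique-⊆-⊇⇒length≡ (neighbours-unique v) !xs
    (complete ∘ ∈-neighbours⁻) (∈-neighbours⁺ ∘ sound)

  ∼⇒≢ : ∀ {u v} → u ∼ v → u ≢ v
  ∼⇒≢ u∼v u≡v = ∼-irrefl u≡v u∼v

  -- Irreflexivity of `_∼_` makes `a`, `b`, `c` distinct, so this excludes exactly the 3-cycles.
  TriangleFree : Set
  TriangleFree = ∀ {a b c} → a ∼ b → b ∼ c → c ∼ a → ⊥

  -- This is the absence of 4-cycles, put as an equality so that it directly identifies two branches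
  -- with a vertex in common.
  UniqueCommonNeighbours : Set
  UniqueCommonNeighbours = ∀ {a b c d} → a ∼ b → b ∼ c → c ∼ d → d ∼ a → a ≢ c → b ≡ d

  girth5⇒triangleFree : HasGirth 5 → TriangleFree
  girth5⇒triangleFree (_ , 5≤) {a} {b} {c} ab bc ca = case 5≤ 3 triangle of λ { (s≤s (s≤s (s≤s ()))) }
    where
    triangle : Cycle 3
    triangle = record
      { start = a ; rest = b ∷ c ∷ [] ; length≡k = refl ; 3≤k = ℕ.≤-refl
      ; distinct = (∼⇒≢ ab ∷ ≢-sym (∼⇒≢ ca) ∷ []) ∷ (∼⇒≢ bc ∷ []) ∷ [] ∷ []
      ; closed = ab ∷ bc ∷ ca ∷ [-] }

  girth5⇒uniqueCommonNeighbours : HasGirth 5 → UniqueCommonNeighbours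
  girth5⇒uniqueCommonNeighbours (_ , 5≤) {a} {b} {c} {d} ab bc cd da a≢c with b ≟ᵥ d
  ... | yes b≡d = b≡d
  ... | no  b≢d = case 5≤ 4 quadrilateral of λ { (s≤s (s≤s (s≤s (s≤s ())))) }
    where
    quadrilateral : Cycle 4
    quadrilateral = record
      { start = a ; rest = b ∷ c ∷ d ∷ [] ; length≡k = refl ; 3≤k = ℕ.n≤1+n 3
      ; distinct = (∼⇒≢ ab ∷ a≢c ∷ ≢-sym (∼⇒≢ da) ∷ []) ∷ (∼⇒≢ bc ∷ b≢d ∷ [])
                   ∷ (∼⇒≢ cd ∷ []) ∷ [] ∷ []
      ; closed = ab ∷ bc ∷ cd ∷ da ∷ [-] }

  girth≥5 : TriangleFree → UniqueCommonNeighbours → ∀ k → Cycle k → 5 ≤ k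
  girth≥5 noTriangle commonUnique k cycle = go k (length≡k cycle) (3≤k cycle) (distinct cycle) (closed cycle)
    where
    open Cycle
    go : ∀ k {v vs} → length (v ∷ vs) ≡ k → 3 ≤ k → Unique (v ∷ vs) →
         Linked _∼_ (v ∷ vs ++ [ v ]) → 5 ≤ k
    -- The bound `3 ≤ k` discards one and two vertices, three or four vertices form a forbidden
    -- cycle, and any longer list has length at least 5.
    go k {vs = []} refl (s≤s ())
    go k {vs = b ∷ []} refl (s≤s (s≤s ()))
    go k {vs = b ∷ c ∷ []} refl _ _ (ab ∷ bc ∷ ca ∷ [-]) = ⊥-elim (noTriangle ab bc ca)
    go k {vs = b ∷ c ∷ d ∷ []} refl _ ((_ ∷ a≢c ∷ _) ∷ (_ ∷ b≢d ∷ []) ∷ _)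
       (ab ∷ bc ∷ cd ∷ da ∷ [-]) = contradiction (commonUnique ab bc cd da a≢c) b≢d
    go k {vs = b ∷ c ∷ d ∷ e ∷ vs} refl _ _ _ = s≤s (s≤s (s≤s (s≤s (s≤s z≤n))))

  -- Downs' lower bound for girth 5.

  downs : TriangleFree → UniqueCommonNeighbours →
          ∀ {n} → (∀ u → n ≤ degree u) → ∀ v → 1 + degree v * n ≤ order
  downs noTriangle commonUnique {n} n≤degree v =
    ℕ.≤-trans (s≤s (length-concatMap-≥ branch n≤length (neighbours v)))
      (length≤order (∉⇒unique-∷ v∉branches
        (concatMap-unique branch (neighbours-unique v) (All.tabulate λ {u} _ → branch-unique u)
          λ x∈ y∈ → branch-disjoint (∈-neighbours⁻ x∈) (∈-neighbours⁻ y∈))))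
    where
    -- For a neighbour `u` of `v`, the head `u` makes up for the removed `v`, so the branch has
    -- exactly as many entries as `u` has neighbours.
    branch : Vertex → List Vertex
    branch u = u ∷ remove _≟ᵥ_ v (neighbours u)

    ∈-branch⁻ : ∀ {u w} → w ∈ branch u → w ≡ u ⊎ (u ∼ w × w ≢ v)
    ∈-branch⁻ (here w≡u) = inj₁ w≡u
    ∈-branch⁻ {u} (there w∈) =
      let w∈N , w≢v = ∈-filter⁻ (λ y → ¬? (y ≟ᵥ v)) {xs = neighbours u} w∈ in inj₂ (∈-neighbours⁻ w∈N , w≢v)

    branch-unique : ∀ u → Unique (branch u)
    branch-unique u = ∉⇒unique-∷
      (λ u∈ → ∼-irrefl refl (∈-neighbours⁻ (proj₁ (∈-filter⁻ (λ y → ¬? (y ≟ᵥ v)) {xs = neighbours u} u∈))))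
      (Unique.filter⁺ (λ y → ¬? (y ≟ᵥ v)) (neighbours-unique u))

    n≤length : ∀ u → n ≤ length (branch u)
    n≤length u = ℕ.≤-trans (n≤degree u)
      -- Replacing the head `u` of the branch by `v` keeps the length and yields a list containing
      -- all neighbours of `u`.
      (unique-⊆⇒length≤ (neighbours-unique u) (⊆-∷-remove _≟ᵥ_ v (neighbours u)))

    -- If `z` is the root of just one of the branches, then `x`, `y` and `v` form a triangle. If it
    -- is the root of neither, then `x` and `y` are common neighbours of the distinct vertices `v`
    -- and `z`.
    branch-disjoint : ∀ {x y z} → v ∼ x → v ∼ y → z ∈ branch x → z ∈ branch y → x ≡ y
    branch-disjoint vx vy z∈x z∈y with ∈-branch⁻ z∈x | ∈-branch⁻ z∈y
    ... | inj₁ refl      | inj₁ z≡y       = z≡y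
    ... | inj₁ refl      | inj₂ (yz , _)  = ⊥-elim (noTriangle vy yz (∼-sym vx))
    ... | inj₂ (xz , _)  | inj₁ refl      = ⊥-elim (noTriangle vx xz (∼-sym vy))
    ... | inj₂ (xz , z≢v) | inj₂ (yz , _) = commonUnique vx xz (∼-sym yz) (∼-sym vy) (≢-sym z≢v)

    v∉branches : ¬ v ∈ concatMap branch (neighbours v)
    v∉branches v∈ with u , u∈ , v∈u ← find (∈-concatMap⁻ branch {xs = neighbours v} v∈)
                  with ∈-branch⁻ v∈u
    ... | inj₁ refl      = ∼-irrefl refl (∈-neighbours⁻ u∈)
    ... | inj₂ (_ , v≢v) = v≢v refl

  -- The bound is applied at a vertex of the larger degree `m`, while `r ≤ m` makes `r` a lower
  -- bound for all degrees.
  downs-degreeSet : ∀ {r m} → r ≤ m → Is[ r ∷ m ∷ [] ⨾ 5 ]Graph G → 1 + m * r ≤ order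
  downs-degreeSet {r} {m} r≤m (girth , degrees)
    with v , refl ← Equivalence.to (degrees m) (there (here refl)) =
    downs (girth5⇒triangleFree girth) (girth5⇒uniqueCommonNeighbours girth) r≤degree v
    where
    r≤degree : ∀ u → r ≤ degree u
    r≤degree u with Equivalence.from (degrees (degree u)) (u , refl)
    ... | here eq         = ℕ.≤-reflexive (sym eq)
    ... | there (here eq) = subst (r ≤_) (sym eq) r≤m

-- The graph R_q

module _ {q : ℕ} (F : FieldOfOrder q) where
  open FieldOfOrder F
  open IsHeytingField isHeytingField
    using (isCommutativeRing; #⇒invertible; invertible⇒#; +-comm; +-assoc; +-identityˡ; *-assoc; *-identityˡ; *-identityʳ; zeroˡ)

  private
    commutativeRing : CommutativeRing _ _
    commutativeRing = record { isCommutativeRing = isCommutativeRing }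

    open CommutativeRing commutativeRing using (ring; _-_)
    open RingProperties ring using (x[y-z]≈xy-xz; //-rightDividesˡ; //-rightDividesʳ)

  -- Field arithmetic and coordinates of points and lines.

  -- If 0 = 1, all elements are equal, so 0 - 0 is invertible and 0 would be apart from itself.
  0≢1 : 0ᶠ ≢ 1ᶠ
  0≢1 0≡1 = invertible⇒# {0ᶠ} {0ᶠ} (0ᶠ , collapse _ , collapse _) refl
    where
    collapse : ∀ x → x ≡ 1ᶠ
    collapse x = trans (sym (*-identityˡ x)) (trans (cong (_*ᶠ x) (sym 0≡1)) (trans (zeroˡ x) 0≡1))

  -- The factor is a difference because the Heyting field axiom supplies inverses for differences of
  -- apart elements.
  *-cancelʳ-x-y : ∀ {a b x y} → x ≢ y → a *ᶠ (x - y) ≡ b *ᶠ (x - y) → a ≡ b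
  *-cancelʳ-x-y {a} {b} {x} {y} x≢y eq with i , _ , inverse ← #⇒invertible x≢y = begin
    a                      ≡⟨ *-identityʳ a ⟨
    a *ᶠ 1ᶠ                ≡⟨ cong (a *ᶠ_) inverse ⟨
    a *ᶠ ((x - y) *ᶠ i)    ≡⟨ *-assoc a _ i ⟨
    (a *ᶠ (x - y)) *ᶠ i    ≡⟨ cong (_*ᶠ i) eq ⟩
    (b *ᶠ (x - y)) *ᶠ i    ≡⟨ *-assoc b _ i ⟩
    b *ᶠ ((x - y) *ᶠ i)    ≡⟨ cong (b *ᶠ_) inverse ⟩
    b *ᶠ 1ᶠ                ≡⟨ *-identityʳ b ⟩
    b                      ∎
    where open ≡-Reasoning

  x-y≡z-w⇒x-z≡y-w : ∀ {a b c d} → a - b ≡ c - d → a - c ≡ b - d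
  x-y≡z-w⇒x-z≡y-w {a} {b} {c} {d} eq = begin
    a - c                    ≡⟨ cong (_- c) (//-rightDividesˡ b a) ⟨
    ((a - b) +ᶠ b) - c       ≡⟨ cong (λ e → (e +ᶠ b) - c) eq ⟩
    ((c - d) +ᶠ b) - c       ≡⟨ cong (_- c) (trans (+-assoc c _ b) (+-comm c _)) ⟩
    (((-ᶠ d) +ᶠ b) +ᶠ c) - c ≡⟨ //-rightDividesʳ c _ ⟩
    (-ᶠ d) +ᶠ b              ≡⟨ +-comm _ b ⟩
    b - d                    ∎
    where open ≡-Reasoning

  -- (x , y)₀ is incident to (m , b)₁ exactly when b = intercept x y m, also for m = nothing.
  intercept : Carrier → Carrier → Maybe Carrier → Carrier
  intercept x y (just m) = y - m *ᶠ x
  intercept x y nothing  = x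

  -- Parametrises the points of a line: by the abscissa for a slope in the field, by the ordinate
  -- for a vertical line.
  pointAt : Maybe Carrier → Carrier → Carrier → V F
  pointAt (just m) b t = point t (m *ᶠ t +ᶠ b)
  pointAt nothing  b t = point b t

  intercept-injective-y : ∀ {x y y′ m} → intercept x y (just m) ≡ intercept x y′ (just m) → y ≡ y′
  intercept-injective-y {x} {y} {y′} {m} eq =
    trans (sym (//-rightDividesˡ _ y)) (trans (cong (_+ᶠ m *ᶠ x) eq) (//-rightDividesˡ _ y′))

  -- Two lines of different slopes meet at most once. A vertical line fixes the abscissa, and the
  -- other line then fixes the ordinate; two slopes in the field are compared through the rise y -
  -- y′.
  intercepts-determine-point : ∀ {x y x′ y′} m n → m ≢ n →
    intercept x y m ≡ intercept x′ y′ m → intercept x y n ≡ intercept x′ y′ n →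
    point {F = F} x y ≡ point x′ y′
  intercepts-determine-point nothing nothing m≢n _ _ = contradiction refl m≢n
  intercepts-determine-point {x} nothing (just n) _ refl e =
    cong (point x) (intercept-injective-y {m = n} e)
  intercepts-determine-point {x} (just m) nothing _ e refl =
    cong (point x) (intercept-injective-y {m = m} e)
  intercepts-determine-point {x} {y} {x′} {y′} (just m) (just n) m≢n e e′ with x ≟ x′
  ... | yes refl = cong (point x) (intercept-injective-y {m = m} e)
  -- Both slopes times x - x′ give y - y′, so cancelling x - x′ would make them equal.
  ... | no  x≢x′ = contradiction (cong just (*-cancelʳ-x-y x≢x′ (trans (sym (rise m e)) (rise n e′)))) m≢n
    where
    rise : ∀ k → intercept x y (just k) ≡ intercept x′ y′ (just k) → y - y′ ≡ k *ᶠ (x - x′)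
    rise k eq = trans (x-y≡z-w⇒x-z≡y-w eq) (sym (x[y-z]≈xy-xz k x x′))

  -- A coordinate description of adjacency in R_q.

  -- Defined by recursion on both ends, without orientation, so that matching on the kinds of
  -- vertices yields plain equations in the field. Two lines are joined when they are parallel and
  -- exactly one of them is the centre of their star.
  Adjacent : V F → V F → Set
  Adjacent (point x y) (point _ _)  = ⊥
  Adjacent (point x y) (line m b)   = b ≡ intercept x y m
  Adjacent (line m b)  (point x y)  = b ≡ intercept x y m
  Adjacent (line m b)  (line m′ b′) = m ≡ m′ × (b ≡ 0ᶠ × b′ ≢ 0ᶠ ⊎ b′ ≡ 0ᶠ × b ≢ 0ᶠ)

  open Graph (R F) using (_∼_)

  private
    incident⇒intercept : ∀ {x y m b} → y ≡ m *ᶠ x +ᶠ b → b ≡ intercept x y (just m)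
    incident⇒intercept {x} {m = m} {b} refl =
      trans (sym (//-rightDividesʳ (m *ᶠ x) b)) (cong (_- m *ᶠ x) (+-comm b _))

    intercept⇒incident : ∀ {x y m b} → b ≡ intercept x y (just m) → y ≡ m *ᶠ x +ᶠ b
    intercept⇒incident {x} {y} {m} refl = trans (sym (//-rightDividesˡ (m *ᶠ x) y)) (+-comm _ _)

    intercept⇒ER : ∀ {x y b} m → b ≡ intercept x y m → ER F (point x y) (line m b)
    intercept⇒ER (just m) e    = fromA (fromB (incident (intercept⇒incident e)))
    intercept⇒ER nothing  refl = fromA joinA

  ∼⇒adjacent : ∀ {u v} → u ∼ v → Adjacent u v
  ∼⇒adjacent (fwd (fromA (fromB (incident e)))) = incident⇒intercept e
  ∼⇒adjacent (fwd (fromA joinA))                = refl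
  ∼⇒adjacent (fwd (star b≢0))                   = refl , inj₁ (refl , b≢0)
  ∼⇒adjacent (bwd (fromA (fromB (incident e)))) = incident⇒intercept e
  ∼⇒adjacent (bwd (fromA joinA))                = refl
  ∼⇒adjacent (bwd (star b≢0))                   = refl , inj₂ (refl , b≢0)

  adjacent⇒∼ : ∀ {u v} → Adjacent u v → u ∼ v
  adjacent⇒∼ {point _ _} {line m _}  e = fwd (intercept⇒ER m e)
  adjacent⇒∼ {line m _}  {point _ _} e = bwd (intercept⇒ER m e)
  adjacent⇒∼ {line _ _}  {line _ _} (refl , inj₁ (refl , b≢0)) = fwd (star b≢0)
  adjacent⇒∼ {line _ _}  {line _ _} (refl , inj₂ (refl , b≢0)) = bwd (star b≢0)

  -- Absence of 3-cycles and 4-cycles in R_q.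

  private
    adjacent-lines-≢ : ∀ {m b b′} → Adjacent (line m b) (line m b′) → b ≢ b′
    adjacent-lines-≢ (_ , inj₁ (b≡0 , b′≢0)) refl = b′≢0 b≡0
    adjacent-lines-≢ (_ , inj₂ (b′≡0 , b≢0)) refl = b≢0 b′≡0

    -- Points are never adjacent, so `b` and `c` are lines. Being adjacent they are parallel, and
    -- only one line of each slope passes through a point.
    no-triangle-at-point : ∀ {x y} b c → Adjacent (point x y) b → Adjacent b c → Adjacent c (point x y) → ⊥
    no-triangle-at-point (line m b) (line .m c) pb bc@(refl , _) cp =
      adjacent-lines-≢ bc (trans pb (sym cp))

  triangleFree : TriangleFree (R F)
  triangleFree {a} {b} {c} ab bc ca = go a b c (∼⇒adjacent ab) (∼⇒adjacent bc) (∼⇒adjacent ca)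
    where
    go : ∀ a b c → Adjacent a b → Adjacent b c → Adjacent c a → ⊥
    go (point _ _) b c = no-triangle-at-point b c
    -- A triangle containing a point is rotated so as to start there.
    go a@(line _ _) (point _ _) c ab bc ca = no-triangle-at-point c a bc ca ab
    go a@(line _ _) b@(line _ _) (point _ _) ab bc ca = no-triangle-at-point a b ca ab bc
    -- Each edge between lines has exactly one end of intercept zero, which cannot alternate around
    -- a cycle of odd length.
    go (line _ _) (line _ _) (line _ _) (_ , inj₁ (_ , b≢0)) (_ , inj₁ (b≡0 , _)) _ = b≢0 b≡0
    go (line _ _) (line _ _) (line _ _) (_ , inj₁ (a≡0 , _)) (_ , inj₂ _) (_ , inj₁ (_ , a≢0)) = a≢0 a≡0
    go (line _ _) (line _ _) (line _ _) _ (_ , inj₂ (c≡0 , _)) (_ , inj₂ (_ , c≢0)) = c≢0 c≡0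
    go (line _ _) (line _ _) (line _ _) (_ , inj₂ (b≡0 , _)) (_ , inj₂ (_ , b≢0)) _ = b≢0 b≡0
    go (line _ _) (line _ _) (line _ _) _ (_ , inj₁ (_ , c≢0)) (_ , inj₁ (c≡0 , _)) = c≢0 c≡0
    go (line _ _) (line _ _) (line _ _) (_ , inj₂ (_ , a≢0)) (_ , inj₁ _) (_ , inj₂ (a≡0 , _)) = a≢0 a≡0

  private
    star-zero⇒nonzero : ∀ {m m′ b b′} → Adjacent (line m b) (line m′ b′) → b ≡ 0ᶠ → b′ ≢ 0ᶠ
    star-zero⇒nonzero (_ , inj₁ (_ , b′≢0)) _   = b′≢0
    star-zero⇒nonzero (_ , inj₂ (_ , b≢0))  b≡0 = contradiction b≡0 b≢0

    star-nonzero⇒zero : ∀ {m m′ b b′} → Adjacent (line m b) (line m′ b′) → b ≢ 0ᶠ → b′ ≡ 0ᶠ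
    star-nonzero⇒zero (_ , inj₁ (b≡0 , _))  b≢0 = contradiction b≡0 b≢0
    star-nonzero⇒zero (_ , inj₂ (b′≡0 , _)) _   = b′≡0

    adjacent-sym : ∀ u v → Adjacent u v → Adjacent v u
    adjacent-sym (point _ _) (line _ _)  e        = e
    adjacent-sym (line _ _)  (point _ _) e        = e
    adjacent-sym (line _ _)  (line _ _)  (eq , s) = sym eq , Sum.swap s

    -- The neighbours `b` and `d` of the point are lines, and they coincide if parallel. If `c` is a
    -- line, both are parallel to it; if `c` is a point and they are not parallel, they meet only
    -- once, so `c` is the initial point.
    no-quadrilateral-at-point : ∀ {x y} b c d → Adjacent (point x y) b → Adjacent b c → Adjacent c d →
      Adjacent d (point x y) → point x y ≢ c → b ≢ d → ⊥
    no-quadrilateral-at-point (line m b) (point _ _) (line n d) ab bc cd da a≢c b≢d with ≡-dec _≟_ m n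
    ... | yes refl = b≢d (cong (line m) (trans ab (sym da)))
    ... | no  m≢n  = a≢c (intercepts-determine-point m n m≢n (trans (sym ab) bc) (trans (sym da) cd))
    no-quadrilateral-at-point (line m b) (line _ _) (line _ d) ab (refl , _) (refl , _) da a≢c b≢d =
      b≢d (cong (line m) (trans ab (sym da)))

  uniqueCommonNeighbours : UniqueCommonNeighbours (R F)
  uniqueCommonNeighbours {a} {b} {c} {d} ab bc cd da a≢c with inj⇒≟ (↔⇒↣ (↔-sym (enumV F))) b d
  ... | yes b≡d = b≡d
  ... | no  b≢d = ⊥-elim
    (go a b c d (∼⇒adjacent ab) (∼⇒adjacent bc) (∼⇒adjacent cd) (∼⇒adjacent da) a≢c b≢d)
    where
    go : ∀ a b c d → Adjacent a b → Adjacent b c → Adjacent c d → Adjacent d a → a ≢ c → b ≢ d → ⊥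
    go (point _ _) b c d = no-quadrilateral-at-point b c d
    -- The cycle is started at its first point; each shift by one exchanges the two diagonals.
    go a@(line _ _) (point _ _) c d ab bc cd da a≢c b≢d =
      no-quadrilateral-at-point c d a bc cd da ab b≢d (≢-sym a≢c)
    go a@(line _ _) b@(line _ _) (point _ _) d ab bc cd da a≢c b≢d =
      no-quadrilateral-at-point d a b cd da ab bc (≢-sym a≢c) (≢-sym b≢d)
    go a@(line _ _) b@(line _ _) c@(line _ _) (point _ _) ab bc cd da a≢c b≢d =
      no-quadrilateral-at-point a b c da ab bc cd (≢-sym b≢d) a≢c
    -- All four lines lie in one star and alternate between its centre and its leaves, so either `a`
    -- and `c` or `b` and `d` are both the centre.
    go a@(line m x) b@(line _ _) c@(line _ _) d@(line _ _)
       ab@(refl , _) bc@(refl , _) cd@(refl , _) da@(refl , _) a≢c b≢d with x ≟ 0ᶠ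
    ... | yes x≡0 = a≢c (cong (line m) (trans x≡0 (sym (star-nonzero⇒zero bc (star-zero⇒nonzero ab x≡0)))))
    ... | no  x≢0 = b≢d (cong (line m)
      (trans (star-nonzero⇒zero ab x≢0) (sym (star-nonzero⇒zero (adjacent-sym d a da) x≢0))))

  -- Degrees in R_q.

  private
    elements : List Carrier
    elements = tabulate (Inverse.to enum)

    elements-unique : Unique elements
    elements-unique = tabulate-unique enum

    ∈-elements : ∀ x → x ∈ elements
    ∈-elements = tabulate-complete enum

    slopes : List (Maybe Carrier)
    slopes = nothing ∷ map just elements

    slopes-unique : Unique slopes
    slopes-unique = ∉⇒unique-∷ (λ n∈ → case ∈-map⁻ just n∈ of λ { (_ , _ , ()) })
      (Unique.map⁺ just-injective elements-unique)

    ∈-slopes : ∀ m → m ∈ slopes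
    ∈-slopes nothing  = here refl
    ∈-slopes (just m) = there (∈-map⁺ just (∈-elements m))

    nonzeros : List Carrier
    nonzeros = remove _≟_ 0ᶠ elements

    ∈-nonzeros⁺ : ∀ {b} → b ≢ 0ᶠ → b ∈ nonzeros
    ∈-nonzeros⁺ b≢0 = ∈-filter⁺ (λ y → ¬? (y ≟ 0ᶠ)) (∈-elements _) b≢0

    ∈-nonzeros⁻ : ∀ {b} → b ∈ nonzeros → b ≢ 0ᶠ
    ∈-nonzeros⁻ b∈ = proj₂ (∈-filter⁻ (λ y → ¬? (y ≟ 0ᶠ)) {xs = elements} b∈)

    pointAt-injective : ∀ m b {t t′} → pointAt m b t ≡ pointAt m b t′ → t ≡ t′
    pointAt-injective (just _) b refl = refl
    pointAt-injective nothing  b refl = refl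

    pointAt-adjacent : ∀ m b t → Adjacent (line m b) (pointAt m b t)
    pointAt-adjacent (just m) b t = incident⇒intercept refl
    pointAt-adjacent nothing  b t = refl

    pointsOn : Maybe Carrier → Carrier → List (V F)
    pointsOn m b = map (pointAt m b) elements

    pointsOn-unique : ∀ m b → Unique (pointsOn m b)
    pointsOn-unique m b = Unique.map⁺ (pointAt-injective m b) elements-unique

    length-pointsOn : ∀ m b → length (pointsOn m b) ≡ q
    length-pointsOn m b = trans (length-map (pointAt m b) elements) (length-tabulate (Inverse.to enum))

    line-∉-pointsOn : ∀ {n c} m b → ¬ line n c ∈ pointsOn m b
    line-∉-pointsOn m b l∈ with ∈-map⁻ (pointAt m b) l∈
    -- `pointAt` reduces to a point only after its slope is split.
    line-∉-pointsOn (just _) b l∈ | _ , _ , ()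
    line-∉-pointsOn nothing  b l∈ | _ , _ , ()

    ∈-pointsOn⁺ : ∀ {x y} m b → Adjacent (line m b) (point x y) → point x y ∈ pointsOn m b
    ∈-pointsOn⁺ {x} (just m) b e = subst (λ y → point x y ∈ pointsOn (just m) b)
      (sym (intercept⇒incident e)) (∈-map⁺ (pointAt (just m) b) (∈-elements x))
    ∈-pointsOn⁺ {y = y} nothing b refl = ∈-map⁺ (pointAt nothing b) (∈-elements y)

    ∈-pointsOn⁻ : ∀ {v} m b → v ∈ pointsOn m b → Adjacent (line m b) v
    ∈-pointsOn⁻ m b v∈ with t , _ , refl ← ∈-map⁻ (pointAt m b) v∈ = pointAt-adjacent m b t

  open Graph (R F) using (degree)

  -- Exactly one line of each of the q + 1 slopes, vertical included, passes through the point.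
  degree-point : ∀ x y → degree (point x y) ≡ q + 1
  degree-point x y = begin
    degree (point x y)          ≡⟨ degree-≡ (R F) lines-unique (adjacent⇒∼ ∘ sound) (complete _ ∘ ∼⇒adjacent) ⟩
    length lines                ≡⟨ length-map through slopes ⟩
    suc (length (map just elements)) ≡⟨ cong suc (trans (length-map just elements) (length-tabulate (Inverse.to enum))) ⟩
    suc q                       ≡⟨ ℕ.+-comm 1 q ⟩
    q + 1                       ∎
    where
    open ≡-Reasoning
    through : Maybe Carrier → V F
    through m = line m (intercept x y m)
    lines : List (V F)
    lines = map through slopes
    lines-unique : Unique lines
    lines-unique = Unique.map⁺ (λ { refl → refl }) slopes-unique
    sound : ∀ {w} → w ∈ lines → Adjacent (point x y) w
    sound w∈ with _ , _ , refl ← ∈-map⁻ through w∈ = refl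
    complete : ∀ w → Adjacent (point x y) w → w ∈ lines
    complete (line m _) refl = ∈-map⁺ through (∈-slopes m)

  -- The neighbours are the q points of the line and the centre of its star.
  degree-line-≢0 : ∀ m {b} → b ≢ 0ᶠ → degree (line m b) ≡ q + 1
  degree-line-≢0 m {b} b≢0 = begin
    degree (line m b)             ≡⟨ degree-≡ (R F) (∉⇒unique-∷ (line-∉-pointsOn m b) (pointsOn-unique m b))
                                              (adjacent⇒∼ ∘ sound) (complete _ ∘ ∼⇒adjacent) ⟩
    suc (length (pointsOn m b))   ≡⟨ cong suc (length-pointsOn m b) ⟩
    suc q                         ≡⟨ ℕ.+-comm 1 q ⟩
    q + 1                         ∎
    where
    open ≡-Reasoning
    sound : ∀ {w} → w ∈ line m 0ᶠ ∷ pointsOn m b → Adjacent (line m b) w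
    sound (here refl) = refl , inj₂ (refl , b≢0)
    sound (there w∈)  = ∈-pointsOn⁻ m b w∈
    complete : ∀ w → Adjacent (line m b) w → w ∈ line m 0ᶠ ∷ pointsOn m b
    complete (point _ _) e = there (∈-pointsOn⁺ m b e)
    complete (line _ _) (refl , inj₁ (b≡0 , _)) = contradiction b≡0 b≢0
    complete (line _ _) (refl , inj₂ (refl , _)) = here refl

  -- The centre of a star has its q points and the q - 1 leaves as neighbours, and q + (q - 1) = 2(q
  -- + 1) - 3.
  degree-line-0 : ∀ m → degree (line m 0ᶠ) ≡ 2 * (q + 1) ∸ 3
  degree-line-0 m = begin
    degree (line m 0ᶠ)
      ≡⟨ degree-≡ (R F) unique (adjacent⇒∼ ∘ sound) (complete _ ∘ ∼⇒adjacent) ⟩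
    length (pointsOn m 0ᶠ ++ map (line m) nonzeros)
      ≡⟨ length-++ (pointsOn m 0ᶠ) ⟩
    length (pointsOn m 0ᶠ) + length (map (line m) nonzeros)
      ≡⟨ cong₂ _+_ (length-pointsOn m 0ᶠ) (length-map (line m) nonzeros) ⟩
    q + length nonzeros
      ≡⟨ arithmetic 1+nonzeros ⟩
    2 * (q + 1) ∸ 3 ∎
    where
    open ≡-Reasoning
    unique : Unique (pointsOn m 0ᶠ ++ map (line m) nonzeros)
    unique = Unique.++⁺ (pointsOn-unique m 0ᶠ)
      (Unique.map⁺ (λ { refl → refl }) (Unique.filter⁺ (λ y → ¬? (y ≟ 0ᶠ)) elements-unique))
      λ (w∈ , w∈′) → case ∈-map⁻ (line m) w∈′ of λ { (_ , _ , refl) → line-∉-pointsOn m 0ᶠ w∈ }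
    sound : ∀ {w} → w ∈ pointsOn m 0ᶠ ++ map (line m) nonzeros → Adjacent (line m 0ᶠ) w
    sound w∈ with ∈-++⁻ (pointsOn m 0ᶠ) w∈
    ... | inj₁ w∈points = ∈-pointsOn⁻ m 0ᶠ w∈points
    ... | inj₂ w∈lines with b , b∈ , refl ← ∈-map⁻ (line m) w∈lines = refl , inj₁ (refl , ∈-nonzeros⁻ b∈)
    complete : ∀ w → Adjacent (line m 0ᶠ) w → w ∈ pointsOn m 0ᶠ ++ map (line m) nonzeros
    complete (point _ _) e = ∈-++⁺ˡ (∈-pointsOn⁺ m 0ᶠ e)
    complete (line _ _) (refl , inj₁ (_ , b≢0)) = ∈-++⁺ʳ (pointsOn m 0ᶠ) (∈-map⁺ (line m) (∈-nonzeros⁺ b≢0))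
    complete (line _ _) (refl , inj₂ (_ , 0≢0)) = contradiction refl 0≢0
    1+nonzeros : suc (length nonzeros) ≡ q
    1+nonzeros = trans (length-remove _≟_ elements-unique (∈-elements 0ᶠ)) (length-tabulate (Inverse.to enum))
    -- Exhibiting 3 as a summand shows that the truncated subtraction is a true one.
    rearrange : ∀ n → 2 * (suc n + 1) ≡ 3 + (suc n + n)
    rearrange = solve-∀
    arithmetic : ∀ {n q} → suc n ≡ q → q + n ≡ 2 * (q + 1) ∸ 3
    arithmetic {n} refl = sym (cong (_∸ 3) (rearrange n))

  -- Girth and degree set of R_q.

  -- The parallel lines y = 0 and y = 1 are joined by a star edge and meet the vertical line x = 0
  -- in the points (0, 0) and (0, 1).
  pentagon : Graph.Cycle (R F) 5
  pentagon = record
    { start    = line m 0ᶠ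
    ; rest     = line m 1ᶠ ∷ point 0ᶠ 1ᶠ ∷ line nothing 0ᶠ ∷ point 0ᶠ 0ᶠ ∷ []
    ; length≡k = refl
    ; 3≤k      = s≤s (s≤s (s≤s z≤n))
    ; distinct = ((λ { eq → 0≢1 (line-injective eq) }) ∷ (λ ()) ∷ (λ ()) ∷ (λ ()) ∷ [])
               ∷ ((λ ()) ∷ (λ ()) ∷ (λ ()) ∷ [])
               ∷ ((λ ()) ∷ (λ eq → 0≢1 (sym (point-injective eq))) ∷ [])
               ∷ ((λ ()) ∷ [])
               ∷ [] ∷ []
    ; closed   = fwd (star (≢-sym 0≢1))
               ∷ bwd (fromA (fromB (incident (0*0+ 1ᶠ))))
               ∷ fwd (fromA joinA)
               ∷ bwd (fromA joinA)
               ∷ fwd (fromA (fromB (incident (0*0+ 0ᶠ))))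
               ∷ [-]
    }
    where
    m : Maybe Carrier
    m = just 0ᶠ
    0*0+ : ∀ b → b ≡ 0ᶠ *ᶠ 0ᶠ +ᶠ b
    0*0+ b = sym (trans (cong (_+ᶠ b) (zeroˡ 0ᶠ)) (+-identityˡ b))
    line-injective : ∀ {m b b′} → line {F = F} m b ≡ line m b′ → b ≡ b′
    line-injective refl = refl
    point-injective : ∀ {x y y′} → point {F = F} x y ≡ point x y′ → y ≡ y′
    point-injective refl = refl

  R-isGraph : Is[ q + 1 ∷ 2 * (q + 1) ∸ 3 ∷ [] ⨾ 5 ]Graph (R F)
  R-isGraph = (pentagon , girth≥5 (R F) triangleFree uniqueCommonNeighbours) , λ d → mk⇔
    (λ { (here refl)         → point 0ᶠ 0ᶠ , degree-point 0ᶠ 0ᶠ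
       ; (there (here refl)) → line nothing 0ᶠ , degree-line-0 nothing })
    λ { (v , refl) → degree∈ v }
    where
    degree∈ : ∀ v → degree v ∈ q + 1 ∷ 2 * (q + 1) ∸ 3 ∷ []
    degree∈ (point x y) = here (degree-point x y)
    degree∈ (line m b) with b ≟ 0ᶠ
    ... | yes refl = there (here (degree-line-0 m))
    ... | no  b≢0  = here (degree-line-≢0 m b≢0)

-- Numerical comparison with Downs' bound.

-- The difference of the two degrees is q - 2; for q = 2 they coincide and the degree set is {3}.
q+1≤2[q+1]∸3 : ∀ {q} → 2 ≤ q → q + 1 ≤ 2 * (q + 1) ∸ 3
q+1≤2[q+1]∸3 {suc (suc n)} (s≤s (s≤s _)) =
  subst (suc (suc n) + 1 ≤_) (cong (_∸ 3) (sym (rearrange n))) (ℕ.m≤m+n _ n)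
  where
  rearrange : ∀ n → 2 * (suc (suc n) + 1) ≡ 3 + (suc (suc n) + 1 + n)
  rearrange = solve-∀

-- Both sides equal 2q² + q, since 2(q + 1) - 3 = 2q - 1.
order-R≡1+mr : ∀ {q} → 2 ≤ q → q * q + (1 + q) * q ≡ 1 + (2 * (q + 1) ∸ 3) * (q + 1)
order-R≡1+mr {suc n} _ = trans (expand n) (cong (λ m → 1 + m * (suc n + 1)) (cong (_∸ 3) (sym (rearrange n))))
  where
  expand : ∀ n → suc n * suc n + (1 + suc n) * suc n ≡ 1 + (1 + n + n) * (suc n + 1)
  expand = solve-∀
  rearrange : ∀ n → 2 * (suc n + 1) ≡ 3 + (1 + n + n)
  rearrange = solve-∀

downsBound₅-≡ : ∀ q m → downsBound₅ (q + 1) m ≡ 1 + m * (q + 1)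
downsBound₅-≡ q m = cong suc (begin
  m + m * (q + 1 ∸ 1) ≡⟨ cong (λ n → m + m * n) (ℕ.m+n∸n≡m q 1) ⟩
  m + m * q           ≡⟨ ℕ.*-suc m q ⟨
  m * suc q           ≡⟨ cong (m *_) (ℕ.+-comm 1 q) ⟩
  m * (q + 1)         ∎)
  where open ≡-Reasoning

theorem3p1 : (q : ℕ) → 2 ≤ q → IsPrimePower q → (F : FieldOfOrder q) → (r : ℕ) → r ≡ q + 1 →
    Is[ r ∷ 2 * r ∸ 3 ∷ [] ⨾ 5 ]Cage (R F)
    × Graph.order (R F) ≡ downsBound₅ r (2 * r ∸ 3)
    × (n[ r ∷ 2 * r ∸ 3 ∷ [] ⨾ 5 ]≡ (r * (2 * r ∸ 3) + 1))
theorem3p1 q 2≤q _ F r refl =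
  (R-isGraph F , minimum) ,
  trans order≡1+mr (sym (downsBound₅-≡ q m)) ,
  subst (n[ r ∷ m ∷ [] ⨾ 5 ]≡_) order≡rm+1 (minimum)
  where
  m : ℕ
  m = 2 * r ∸ 3
  order≡1+mr : Graph.order (R F) ≡ 1 + m * r
  order≡1+mr = order-R≡1+mr 2≤q
  order≡rm+1 : Graph.order (R F) ≡ r * m + 1
  order≡rm+1 = trans order≡1+mr (trans (ℕ.+-comm 1 (m * r)) (cong (_+ 1) (ℕ.*-comm m r)))
  minimum : n[ r ∷ m ∷ [] ⨾ 5 ]≡ Graph.order (R F)
  minimum = (R F , R-isGraph F , refl) ,
    -- R_q has exactly 1 + `m` * `r` vertices, so Downs' bound for `G` is the required minimality.
    λ G isGraph → subst (_≤ Graph.order G) (sym order≡1+mr) (downs-degreeSet G (q+1≤2[q+1]∸3 2≤q) isGraph)
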